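{- Let $U$ be a nonempty set, $I$ an interpretation over $U$, $D\subseteq U$ and $E\subseteq\mathcal P(U)$. Let $D_0\subseteq D$ and $E_0\subseteq E$ be countable and nonempty. Then there exist countable sets $N$ and $M$ with $D_0\subseteq N\subseteq D$ and $E_0\subseteq M\subseteq E$ such that $\langle I,N,M\rangle$ is an elementary substructure of $\langle I,D,E\rangle$, i.e. $\langle I,N,M\rangle\subseteq_E\langle I,D,E\rangle$.
   Context: **Syntax.** Relation symbols $R=\mathbb N$, first-order variables $V=\mathbb N$ and second-order (monadic) variables $V_2=\mathbb N$ (the two kinds of variables form separate namespaces). MSO formulas: $\varphi,\psi ::= r(x,y)\mid X(x)\mid\neg\varphi\mid\varphi\wedge\psi\mid\exists x.\varphi\mid\exists X.\varphi$ with $r\in R$, $x,y\in V$, $X\in V_2$ (no equality). **Semantics.** $U$ is a fixed nonempty set (the type of individuals). An interpretation $I$ over $U$ assigns to each $r\in R$ a binary relation $I(r)\subseteq U\times U$. Given $I$, a set $D\subseteq U$, a family $E\subseteq\mathcal P(U)$ (no closure condition on $E$), and assignments $g:V\to U$, $G:V_2\to\mathcal P(U)$, truth $\langle I,D,E\rangle,g,G\models^d\varphi$ is defined recursively: $r(x,y)$ holds iff $(g(x),g(y))\in I(r)$; $X(x)$ holds iff $g(x)\in G(X)$; $\neg,\wedge$ are classical; $\exists x.\varphi$ holds iff $\langle I,D,E\rangle,g[x\leftarrow d],G\models^d\varphi$ for some $d\in D$; $\exists X.\varphi$ holds iff $\langle I,D,E\rangle,g,G\langle X\leftarrow S\rangle\models^d\varphi$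 for some $S\in E$. Here $g[x\leftarrow d]$ and $G\langle X\leftarrow S\rangle$ are the usual updates. **Elementary substructure.** $\langle I',D',E'\rangle\subseteq_E\langle I,D,E\rangle$ means: $D'\subseteq D$, $E'\subseteq E$, and for every formula $\psi$, every $g$ with $\mathrm{Range}(g)\subseteq D'$ and every $G$ with $\mathrm{Range}(G)\subseteq E'$, $\langle I',D',E'\rangle,g,G\models^d\psi$ iff $\langle I,D,E\rangle,g,G\models^d\psi$. (The subscript $E$ in $\subseteq_E$ is just part of the notation.) "Countable" means finite or countably infinite. -}

-- The metatheory of the source is classical.  Agda's is not, so classical
-- reasoning enters the theorem as a hypothesis, ExcludedMiddle from the
-- standard library.  That axiom decides arbitrary types, so it also yields
-- witnesses of Σ-types, and no separate choice axiom is needed.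
module Defs where

open import Data.Bool.Base using (if_then_else_)
open import Data.Fin.Base using (Fin)
open import Data.Nat.Base using (ℕ)
open import Data.Nat.Properties using (_≟_)
open import Data.Product.Base using (∃; ∃-syntax; _×_; proj₁)
open import Data.Sum.Base using (_⊎_)
open import Function.Bundles using (Bijection; _⇔_)
open import Level using (Level; Lift; suc; _⊔_)
open import Relation.Binary.Bundles using (Setoid)
open import Relation.Binary.Core using (Rel)
open import Relation.Binary.Definitions using (_Respects_)
open import Relation.Binary.PropositionalEquality.Properties using (setoid)
import Relation.Binary.Construct.On as On
open import Relation.Nullary.Decidable.Core using (does)
open import Relation.Nullary.Negation.Core using (¬_)
open import Relation.Unary using (Pred; _∈_; _⊆_; _≐_)
open import Relation.Unary.Relation.Binary.Equality using (≐-setoid)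

private
  variable
    a ℓ : Level

infixr 6 _∧′_
infix  7 ¬′_

data Formula : Set where
  rel  : (r x y : ℕ) → Formula
  mem  : (X x : ℕ) → Formula
  ¬′_  : Formula → Formula
  _∧′_ : Formula → Formula → Formula
  ∃₁   : (x : ℕ) → Formula → Formula
  ∃₂   : (X : ℕ) → Formula → Formula

Interpretation : Set ℓ → Set (suc ℓ)
Interpretation {ℓ} U = ℕ → Rel U ℓ

-- Subsets of U are predicates, and two of them are the same set when they are
-- extensionally equal (_≐_).  A set of subsets therefore has to respect _≐_;
-- this is not a closure condition on the family.
record Family (U : Set ℓ) : Set (suc (suc ℓ)) where
  field
    members  : Pred (Pred U ℓ) (suc ℓ)
    respects : members Respects _≐_

open Family public

record Structure (U : Set ℓ) : Set (suc (suc ℓ)) where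
  constructor ⟨_,_,_⟩
  field
    interp  : Interpretation U
    domain  : Pred U ℓ
    subsets : Family U

_[_←_] : {A : Set a} → (ℕ → A) → ℕ → A → (ℕ → A)
(f [ x ← v ]) y = if does (y ≟ x) then v else f y

-- Lift only raises universe levels: quantifying over subsets of U forces truth
-- values into Set (suc ℓ).
infix 4 _,_,_⊨_

_,_,_⊨_ : {U : Set ℓ} → Structure U → (ℕ → U) → (ℕ → Pred U ℓ) →
          Formula → Set (suc ℓ)
_,_,_⊨_ {ℓ} ⟨ I , D , E ⟩ g G (rel r x y) = Lift (suc ℓ) (I r (g x) (g y))
_,_,_⊨_ {ℓ} ⟨ I , D , E ⟩ g G (mem X x)   = Lift (suc ℓ) (g x ∈ G X)
𝔐 , g , G ⊨ ¬′ φ               = ¬ (𝔐 , g , G ⊨ φ)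
𝔐 , g , G ⊨ φ ∧′ ψ             = (𝔐 , g , G ⊨ φ) × (𝔐 , g , G ⊨ ψ)
𝔐@(⟨ I , D , E ⟩) , g , G ⊨ ∃₁ x φ =
  ∃[ d ] d ∈ D × (𝔐 , g [ x ← d ] , G ⊨ φ)
𝔐@(⟨ I , D , E ⟩) , g , G ⊨ ∃₂ X φ =
  ∃[ S ] S ∈ members E × (𝔐 , g , G [ X ← S ] ⊨ φ)

infix 4 _⊆ᴱ_

_⊆ᴱ_ : {U : Set ℓ} → Structure U → Structure U → Set (suc ℓ)
𝔐′@(⟨ I′ , D′ , E′ ⟩) ⊆ᴱ 𝔐@(⟨ I , D , E ⟩) =
  D′ ⊆ D ×
  members E′ ⊆ members E ×
  (∀ ψ g G → (∀ x → g x ∈ D′) → (∀ X → G X ∈ members E′) →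
    (𝔐′ , g , G ⊨ ψ) ⇔ (𝔐 , g , G ⊨ ψ))

-- Elements of a subset are identified by the ambient equality alone,
-- irrespective of their membership proofs.
subsetoid : ∀ {c e p} (A : Setoid c e) → Pred (Setoid.Carrier A) p →
            Setoid (c ⊔ p) e
subsetoid A P = On.setoid {B = ∃ P} A proj₁

module _ {c e p} (A : Setoid c e) (P : Pred (Setoid.Carrier A) p) where

  Finite : Set (c ⊔ e ⊔ p)
  Finite = ∃[ n ] Bijection (setoid (Fin n)) (subsetoid A P)

  CountablyInfinite : Set (c ⊔ e ⊔ p)
  CountablyInfinite = Bijection (setoid ℕ) (subsetoid A P)

  Countable : Set (c ⊔ e ⊔ p)
  Countable = Finite ⊎ CountablyInfinite

CountableSubset : {U : Set ℓ} → Pred U ℓ → Set ℓ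
CountableSubset {U = U} = Countable (setoid U)

CountableFamily : {U : Set ℓ} → Family U → Set (suc ℓ)
CountableFamily {ℓ} {U} E = Countable (≐-setoid U ℓ) (members E)

{-# OPTIONS --safe #-}
-- Downward Löwenheim–Skolem for Henkin semantics.  Close D₀ and E₀ under Skolem
-- functions picking, for every formula ∃x.φ or ∃X.φ and every finite piece of
-- an assignment, a witness in D or in E.  A formula depends on finitely many
-- values of an assignment, so the closure passes the Tarski–Vaught test.  Its
-- elements are the values of Skolem terms, of which there are countably many.
module Submission where

open import Defs
open import Axiom.ExcludedMiddle using (ExcludedMiddle)
open import Data.Bool.Base using (true; false)
open import Data.Empty using (⊥-elim)
open import Data.Fin.Base using (Fin; toℕ; fromℕ<; zero; suc)
open import Data.Fin.Properties using (toℕ<n; fromℕ<-toℕ)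
open import Data.Nat.Base
  using (ℕ; zero; suc; _*_; _⊔_; _≤_; _<_; z≤n; s≤s)
open import Data.Nat.Induction using (<-rec)
open import Data.Nat.Properties
  using ( _≟_; _<?_; <-cmp; <-trans; ≤-<-trans; <⇒≱; ≮⇒≥; ≰⇒>; m<1+n⇒m<n∨m≡n
        ; m≤m⊔n; m≤n⊔m; m<n⇒m<n⊔o; m<n⇒m<o⊔n
        ; suc-injective; *-cancelˡ-≡; even≢odd )
open import Data.Product.Base
  using (∃; ∃-syntax; _×_; _,_; proj₁; proj₂; -,_)
open import Data.Sum.Base using (_⊎_; inj₁; inj₂)
open import Data.Vec.Functional using (_∷_)
open import Function.Base using (_∘_; _$_)
open import Function.Bundles using (Bijection; _⇔_; mk⇔; Equivalence)
open import Function.Definitions using (Injective)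
open import Level using (Level; Lift; lift; lower; 0ℓ)
  renaming (suc to lsuc; _⊔_ to _⊔ˡ_)
open import Relation.Binary.Bundles using (Setoid)
open import Relation.Binary.Core using (Rel)
open import Relation.Binary.Definitions using (tri<; tri≈; tri>)
open import Relation.Binary.PropositionalEquality.Core
  using (_≡_; refl; sym; trans; cong; cong₂; subst)
open import Relation.Binary.PropositionalEquality.Properties using (setoid)
open import Relation.Nullary.Decidable.Core using (yes; no; does; map′)
open import Relation.Nullary.Negation.Core using (¬_; contradiction)
open import Relation.Unary using (Pred; _∈_; _⊆_; _≐_; Satisfiable)
open import Relation.Unary.Properties using (≐-refl; ≐-sym; ≐-trans)
open import Relation.Unary.Relation.Binary.Equality using (≐-setoid)

private
  variable
    a b c e p ℓ : Level

-- Classical choice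

em-lower : ∀ b → ExcludedMiddle (a ⊔ˡ b) → ExcludedMiddle a
em-lower b em = map′ lower lift (em {Lift b _})

module _ {A : Set a} (em : ExcludedMiddle (a ⊔ˡ p)) (default : A) (P : Pred A p) where

  -- Hilbert's choice operator: a positive decision of `∃ P` carries the witness itself, and
  -- `default` makes the operator total.
  ε : A
  ε with em {∃ P}
  ... | yes (x , _) = x
  ... | no _        = default

  ε-spec : ∃ P → P ε
  ε-spec ∃P with em {∃ P}
  ... | yes (_ , Px) = Px
  ... | no ∄P        = contradiction ∃P ∄P

least : ExcludedMiddle p → (P : Pred ℕ p) → ∃ P →
        ∃[ m ] P m × (∀ {k} → P k → m ≤ k)
least em P (n , Pn) = <-rec (λ n → P n → Least) step n Pn
  where
  Least = ∃[ m ] P m × (∀ {k} → P k → m ≤ k)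

  step : ∀ n → (∀ {k} → k < n → P k → Least) → P n → Least
  step n rec Pn with em {∃[ k ] k < n × P k}
  ... | yes (k , k<n , Pk) = rec k<n Pk
  ... | no none            = n , Pn , λ Pk → ≮⇒≥ (λ k<n → none (-, k<n , Pk))

-- Countability and enumerations

module _ (em : ExcludedMiddle e) (S : Setoid c e)
         (f : ℕ → Setoid.Carrier S)
         (f-surjective : ∀ s → ∃[ n ] Setoid._≈_ S (f n) s) where

  private
    module S = Setoid S
    open S using (_≈_)

  -- Fresh indices mark first occurrences, so they select one representative of each class. Whether
  -- they are bounded separates the finite case from the infinite one.
  Fresh : Pred ℕ e
  Fresh n = ∀ k → k < n → ¬ f k ≈ f n

  fresh-index : ∀ s → ∃[ n ] Fresh n × f n ≈ s
  fresh-index s with least em (λ n → f n ≈ s) (f-surjective s)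
  ... | n , fn≈s , min =
    n , (λ k k<n fk≈fn → <⇒≱ k<n (min (S.trans fk≈fn fn≈s))) , fn≈s

  -- Repetitions are dropped along the way: `f n` is prepended only if no earlier entry equals it,
  -- which preserves injectivity.
  distinct-prefix : ∀ n → ∃[ k ] ∃[ h ]
    Injective {A = Fin k} _≡_ _≈_ h × (∀ {j} → j < n → ∃[ i ] h i ≈ f j)
  distinct-prefix zero = 0 , (λ ()) , (λ { {()} }) , λ ()
  distinct-prefix (suc n)
    with k , h , h-inj , h-surj ← distinct-prefix n
    with em {∃[ i ] h i ≈ f n}
  ... | yes old = k , h , h-inj , surj
    where
    surj : ∀ {j} → j < suc n → ∃[ i ] h i ≈ f j
    surj j<1+n with m<1+n⇒m<n∨m≡n j<1+n
    ... | inj₁ j<n  = h-surj j<n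
    ... | inj₂ refl = old
  ... | no new = suc k , f n ∷ h , inj , surj
    where
    inj : Injective _≡_ _≈_ (f n ∷ h)
    inj {zero}  {zero}  _  = refl
    inj {zero}  {suc i} eq = contradiction (i , S.sym eq) new
    inj {suc i} {zero}  eq = contradiction (i , eq) new
    inj {suc i} {suc j} eq = cong suc (h-inj eq)

    surj : ∀ {j} → j < suc n → ∃[ i ] (f n ∷ h) i ≈ f j
    surj j<1+n with m<1+n⇒m<n∨m≡n j<1+n
    ... | inj₁ j<n  = let i , eq = h-surj j<n in suc i , eq
    ... | inj₂ refl = zero , S.refl

  fresh-bounded⇒finite : ∀ n → (∀ {m} → Fresh m → m < n) →
                         ∃[ k ] Bijection (setoid (Fin k)) S
  fresh-bounded⇒finite n bounded
    with k , h , h-inj , h-surj ← distinct-prefix n = k , record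
    { to        = h
    ; cong      = λ { refl → S.refl }
    ; bijective = h-inj , λ s →
        let m , fresh , fm≈s = fresh-index s
            i , hi≈fm        = h-surj (bounded fresh)
        in i , λ { refl → S.trans hi≈fm fm≈s }
    }

  -- `idx` runs through the fresh indices in increasing order, each time jumping to the least one
  -- not yet passed.
  fresh-unbounded⇒infinite : (∀ n → ∃[ m ] n ≤ m × Fresh m) →
                             Bijection (setoid ℕ) S
  fresh-unbounded⇒infinite unbounded = record
    { to        = f ∘ idx
    ; cong      = λ { refl → S.refl }
    ; bijective = inj , λ s →
        let m , fresh , fm≈s = fresh-index s
            -- `idx` grows strictly, so `m` lies below `idx (suc m)` and the search can stop there.
            k , idxk≡m       = idx-surjective (suc m) fresh (idx-lower m)
        in k , λ { refl → S.trans (S.reflexive (cong f idxk≡m)) fm≈s }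
    }
    where
    next : ∀ n → ∃[ m ] (n ≤ m × Fresh m) × (∀ {k} → n ≤ k × Fresh k → m ≤ k)
    next n = least em (λ m → n ≤ m × Fresh m) (unbounded n)

    idx : ℕ → ℕ
    idx zero    = proj₁ (next 0)
    idx (suc n) = proj₁ (next (suc (idx n)))

    idx-fresh : ∀ n → Fresh (idx n)
    idx-fresh zero    = proj₂ (proj₁ (proj₂ (next 0)))
    idx-fresh (suc n) = proj₂ (proj₁ (proj₂ (next (suc (idx n)))))

    idx-step : ∀ n → idx n < idx (suc n)
    idx-step n = proj₁ (proj₁ (proj₂ (next (suc (idx n)))))

    idx-mono : ∀ {m n} → m < n → idx m < idx n
    idx-mono {n = suc n} m<1+n with m<1+n⇒m<n∨m≡n m<1+n
    ... | inj₁ m<n  = <-trans (idx-mono m<n) (idx-step n)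
    ... | inj₂ refl = idx-step n

    idx-lower : ∀ n → n < idx (suc n)
    idx-lower zero    = ≤-<-trans z≤n (idx-step 0)
    idx-lower (suc n) = ≤-<-trans (idx-lower n) (idx-step (suc n))

    -- Minimality in `next` excludes fresh indices before `idx 0` and strictly between consecutive
    -- values of `idx`.
    idx-surjective : ∀ n {m} → Fresh m → m < idx n → ∃[ k ] idx k ≡ m
    idx-surjective zero fresh m<idx =
      contradiction (proj₂ (proj₂ (next 0)) (z≤n , fresh)) (<⇒≱ m<idx)
    idx-surjective (suc n) {m} fresh m<idx with <-cmp m (idx n)
    ... | tri< m<n _ _ = idx-surjective n fresh m<n
    ... | tri≈ _ m≡n _ = n , sym m≡n
    ... | tri> _ _ m>n =
      contradiction (proj₂ (proj₂ (next (suc (idx n)))) (m>n , fresh)) (<⇒≱ m<idx)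

    inj : Injective _≡_ _≈_ (f ∘ idx)
    inj {m} {n} eq with <-cmp m n
    ... | tri< m<n _ _ = contradiction eq (idx-fresh n _ (idx-mono m<n))
    ... | tri≈ _ m≡n _ = m≡n
    ... | tri> _ _ n<m = contradiction (S.sym eq) (idx-fresh m _ (idx-mono n<m))

  enumerable⇒countable : (∃[ k ] Bijection (setoid (Fin k)) S) ⊎ Bijection (setoid ℕ) S
  enumerable⇒countable with em {∃[ n ] ∀ {m} → Fresh m → m < n}
  ... | yes (n , bounded) = inj₁ (fresh-bounded⇒finite n bounded)
  ... | no none           = inj₂ (fresh-unbounded⇒infinite unbounded)
    where
    unbounded : ∀ n → ∃[ m ] n ≤ m × Fresh m
    unbounded n with em {∃[ m ] n ≤ m × Fresh m}
    ... | yes found = found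
    ... | no absent = ⊥-elim $
      none (n , λ fresh → ≰⇒> λ n≤m → absent (-, n≤m , fresh))

module _ (A : Setoid c e) (P : Pred (Setoid.Carrier A) p) where

  private
    module P = Setoid (subsetoid A P)

  countable⇒enumerable : Countable A P → ∃ P →
                         ∃[ f ] ∀ (s : ∃ P) → ∃[ n ] f n P.≈ s
  countable⇒enumerable (inj₂ bij) _ = to , strictlySurjective
    where open Bijection bij
  countable⇒enumerable (inj₁ (n , bij)) s₀ = f , λ s →
    let i , to-i = strictlySurjective s
    in toℕ i , P.trans {f (toℕ i)} {to i} {s} (f-toℕ i) to-i
    where
    open Bijection bij using (to; strictlySurjective)

    f : ℕ → ∃ P
    f m with m <? n
    ... | yes m<n = to (fromℕ< m<n)
    -- Past the end of a finite list the enumeration repeats `s₀`; this is where nonemptiness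
    -- enters.
    ... | no _    = s₀

    f-toℕ : ∀ i → f (toℕ i) P.≈ to i
    f-toℕ i with toℕ i <? n
    ... | yes i<n = P.reflexive (cong to (fromℕ<-toℕ i i<n))
    ... | no i≮n  = contradiction (toℕ<n i) i≮n

-- Binary trees as codes

data Tree : Set where
  leaf : ℕ → Tree
  node : Tree → Tree → Tree

-- 2 ^ m * (2 * n + 1)
pair : ℕ → ℕ → ℕ
pair zero    n = suc (2 * n)
pair (suc m) n = 2 * pair m n

-- Parity separates exponent zero from a positive exponent; halving both sides lowers the exponents.
pair-injective : ∀ m m′ {n n′} → pair m n ≡ pair m′ n′ → m ≡ m′ × n ≡ n′
pair-injective zero    zero {n} {n′} eq =
  refl , *-cancelˡ-≡ n n′ 2 (suc-injective eq)
pair-injective zero    (suc m′) {n} {n′} eq =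
  contradiction (sym eq) (even≢odd (pair m′ n′) n)
pair-injective (suc m) zero {n} {n′} eq =
  contradiction eq (even≢odd (pair m n) n′)
pair-injective (suc m) (suc m′) eq
  with refl , n≡n′ ← pair-injective m m′ (*-cancelˡ-≡ _ _ 2 eq) = refl , n≡n′

-- Exponent 0 is reserved for leaves, and the `suc` in the second clause keeps nodes away from it.
code : Tree → ℕ
code (leaf n)   = pair 0 n
code (node l r) = pair (suc (code l)) (code r)

code-injective : ∀ s t → code s ≡ code t → s ≡ t
code-injective (leaf m)   (leaf n)   eq =
  cong leaf (proj₂ (pair-injective 0 0 {m} {n} eq))
code-injective (leaf m)   (node l r) eq
  with () ← proj₁ (pair-injective 0 (suc (code l)) {m} {code r} eq)
code-injective (node l r) (leaf n)   eq
  with () ← proj₁ (pair-injective (suc (code l)) 0 {code r} {n} eq)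
code-injective (node l r) (node l′ r′) eq
  with l≡l′ , r≡r′ ← pair-injective (suc (code l)) (suc (code l′)) eq =
  cong₂ node (code-injective l l′ (suc-injective l≡l′)) (code-injective r r′ r≡r′)

-- Choice inverts the injective `code`; numbers that code no tree go to `leaf 0`.
tree-enumerable : ExcludedMiddle 0ℓ → ∃[ f ] ∀ t → ∃[ n ] f n ≡ t
tree-enumerable em =
    (λ n → ε em (leaf 0) (λ t → code t ≡ n))
  , λ t → code t , code-injective _ t
      (ε-spec em (leaf 0) (λ s → code s ≡ code t) (t , refl))

⌜_⌝ : Formula → Tree
⌜ rel r x y ⌝ = node (leaf 0) (node (leaf r) (node (leaf x) (leaf y)))
⌜ mem X x ⌝   = node (leaf 1) (node (leaf X) (leaf x))
⌜ ¬′ φ ⌝      = node (leaf 2) ⌜ φ ⌝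
⌜ φ ∧′ ψ ⌝    = node (leaf 3) (node ⌜ φ ⌝ ⌜ ψ ⌝)
⌜ ∃₁ x φ ⌝    = node (leaf 4) (node (leaf x) ⌜ φ ⌝)
⌜ ∃₂ X φ ⌝    = node (leaf 5) (node (leaf X) ⌜ φ ⌝)

-- Decoding is total, with a dummy atom for malformed trees, so that every tree can serve as the
-- head of a Skolem term.
⌞_⌟ : Tree → Formula
⌞ node (leaf 0) (node (leaf r) (node (leaf x) (leaf y))) ⌟ = rel r x y
⌞ node (leaf 1) (node (leaf X) (leaf x)) ⌟                 = mem X x
⌞ node (leaf 2) s ⌟                                        = ¬′ ⌞ s ⌟
⌞ node (leaf 3) (node s t) ⌟                               = ⌞ s ⌟ ∧′ ⌞ t ⌟
⌞ node (leaf 4) (node (leaf x) s) ⌟                        = ∃₁ x ⌞ s ⌟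
⌞ node (leaf 5) (node (leaf X) s) ⌟                        = ∃₂ X ⌞ s ⌟
⌞ _ ⌟                                                      = rel 0 0 0

⌞⌜_⌝⌟ : ∀ φ → ⌞ ⌜ φ ⌝ ⌟ ≡ φ
⌞⌜ rel r x y ⌝⌟ = refl
⌞⌜ mem X x ⌝⌟   = refl
⌞⌜ ¬′ φ ⌝⌟      = cong ¬′_ ⌞⌜ φ ⌝⌟
⌞⌜ φ ∧′ ψ ⌝⌟    = cong₂ _∧′_ ⌞⌜ φ ⌝⌟ ⌞⌜ ψ ⌝⌟
⌞⌜ ∃₁ x φ ⌝⌟    = cong (∃₁ x) ⌞⌜ φ ⌝⌟
⌞⌜ ∃₂ X φ ⌝⌟    = cong (∃₂ X) ⌞⌜ φ ⌝⌟

-- Truth depends on finitely many values of the assignments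

update-∈ : {A : Set a} (P : Pred A p) (g : ℕ → A) (x : ℕ) {v : A} →
           (∀ i → g i ∈ P) → v ∈ P → ∀ i → (g [ x ← v ]) i ∈ P
update-∈ P g x g∈P v∈P i with does (i ≟ x)
... | true  = v∈P
... | false = g∈P i

Agree : {A : Set a} → Rel A p → ℕ → Rel (ℕ → A) p
Agree _∼_ n g g′ = ∀ i → i < n → g i ∼ g′ i

agree-update : {A : Set a} (_∼_ : Rel A p) {n : ℕ} {g g′ : ℕ → A} (x : ℕ) {v : A} →
               v ∼ v → Agree _∼_ n g g′ → Agree _∼_ n (g [ x ← v ]) (g′ [ x ← v ])
agree-update _ x v∼v g∼g′ i i<n with does (i ≟ x)
... | true  = v∼v
... | false = g∼g′ i i<n

-- One strict bound for the variables of both kinds in all atoms, bound occurrences included, so it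
-- passes unchanged through quantifiers.
support : Formula → ℕ
support (rel r x y) = suc (x ⊔ y)
support (mem X x)   = suc (X ⊔ x)
support (¬′ φ)      = support φ
support (φ ∧′ ψ)    = support φ ⊔ support ψ
support (∃₁ x φ)    = support φ
support (∃₂ X φ)    = support φ

module _ {U : Set ℓ} where

  -- One implication suffices: agreement is symmetric, so negation can swap the assignments. Sets
  -- are compared by `≐` because that is all that membership in the hull will provide.
  coincidence : (𝔐 : Structure U) (φ : Formula) {g g′ : ℕ → U} {G G′ : ℕ → Pred U ℓ} →
                Agree _≡_ (support φ) g g′ → Agree _≐_ (support φ) G G′ →
                𝔐 , g , G ⊨ φ → 𝔐 , g′ , G′ ⊨ φ
  coincidence ⟨ I , D , E ⟩ (rel r x y) g≈ G≈ (lift h)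
    rewrite g≈ x (s≤s (m≤m⊔n x y)) | g≈ y (s≤s (m≤n⊔m x y)) = lift h
  coincidence ⟨ I , D , E ⟩ (mem X x) g≈ G≈ (lift h)
    rewrite sym (g≈ x (s≤s (m≤n⊔m X x))) = lift (proj₁ (G≈ X (s≤s (m≤m⊔n X x))) h)
  coincidence 𝔐 (¬′ φ) g≈ G≈ ¬h h = ¬h $
    coincidence 𝔐 φ (λ i i< → sym (g≈ i i<)) (λ i i< → ≐-sym (G≈ i i<)) h
  coincidence 𝔐 (φ ∧′ ψ) g≈ G≈ (h , k) =
      coincidence 𝔐 φ (λ i → g≈ i ∘ inˡ) (λ i → G≈ i ∘ inˡ) h
    , coincidence 𝔐 ψ (λ i → g≈ i ∘ inʳ) (λ i → G≈ i ∘ inʳ) k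
    where
    inˡ : ∀ {i} → i < support φ → i < support φ ⊔ support ψ
    inˡ = m<n⇒m<n⊔o (support ψ)
    inʳ : ∀ {i} → i < support ψ → i < support φ ⊔ support ψ
    inʳ = m<n⇒m<o⊔n (support φ)
  coincidence 𝔐@(⟨ I , D , E ⟩) (∃₁ x φ) g≈ G≈ (d , d∈D , h) =
    d , d∈D , coincidence 𝔐 φ (agree-update _≡_ x refl g≈) G≈ h
  coincidence 𝔐@(⟨ I , D , E ⟩) (∃₂ X φ) g≈ G≈ (S , S∈E , h) =
    S , S∈E , coincidence 𝔐 φ g≈ (agree-update _≐_ X ≐-refl G≈) h

-- The Skolem hull

module Hull (em : ExcludedMiddle (lsuc ℓ)) {U : Set ℓ}
            (I : Interpretation U) (D : Pred U ℓ) (E : Family U)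
            (elem : ℕ → ∃ D) (subset : ℕ → ∃ (members E)) where

  𝔐 : Structure U
  𝔐 = ⟨ I , D , E ⟩

  -- Choosing within `∃ D` and `∃ (members E)` keeps the value in `D` or `E` even where no witness
  -- exists.
  skolem : Formula → (ℕ → U) → (ℕ → Pred U ℓ) → ∃ D × ∃ (members E)
  skolem (∃₁ x φ) g G =
    ε em (elem 0) (λ d → 𝔐 , g [ x ← proj₁ d ] , G ⊨ φ) , subset 0
  skolem (∃₂ X φ) g G =
    elem 0 , ε em (subset 0) (λ S → 𝔐 , g , G [ X ← proj₁ S ] ⊨ φ)
  skolem _        g G = elem 0 , subset 0

  -- A tree is read as a Skolem term: a leaf is a pair of constants, and
  -- node c (node s t) applies the Skolem function of the formula coded by c to
  -- the lists of terms along the right spines of s (first-order variables)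
  -- and t (second-order variables).  A term denotes both an individual and a
  -- set; the component that is not meant is junk inside D or E.
  val : Tree → ∃ D × ∃ (members E)
  env : Tree → ℕ → ∃ D × ∃ (members E)

  val (leaf n)            = elem n , subset n
  val (node c (leaf _))   = elem 0 , subset 0
  val (node c (node s t)) =
    skolem ⌞ c ⌟ (λ i → proj₁ (proj₁ (env s i))) (λ i → proj₁ (proj₂ (env t i)))

  env (leaf _)   _       = elem 0 , subset 0
  env (node s t) zero    = val s
  env (node s t) (suc i) = env t i

  ind : Tree → U
  ind t = proj₁ (proj₁ (val t))

  set : Tree → Pred U ℓ
  set t = proj₁ (proj₂ (val t))

  N : Pred U ℓ
  N u = ∃[ t ] ind t ≡ u

  -- Closing under `≐` yields a `Family` and adds nothing new up to `≐`, so countability survives.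
  M : Family U
  M = record
    { members  = λ S → Lift (lsuc ℓ) (∃[ t ] set t ≐ S)
    ; respects = λ S≐T (lift (t , eq)) → lift (t , ≐-trans eq S≐T)
    }

  N⊆D : N ⊆ D
  N⊆D (t , refl) = proj₂ (proj₁ (val t))

  M⊆E : members M ⊆ members E
  M⊆E (lift (t , eq)) = respects E eq (proj₂ (proj₂ (val t)))

  private
    em₀ : ExcludedMiddle 0ℓ
    em₀ = em-lower (lsuc ℓ) em

    emℓ : ExcludedMiddle ℓ
    emℓ = em-lower (lsuc ℓ) em

    enum : ∃[ f ] ∀ t → ∃[ n ] f n ≡ t
    enum = tree-enumerable em₀

  N-countable : CountableSubset N
  N-countable = enumerable⇒countable emℓ (subsetoid (setoid U) N)
    (λ n → -, proj₁ enum n , refl)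
    (λ (u , t , ind≡u) → let n , eq = proj₂ enum t in n , trans (cong ind eq) ind≡u)

  M-countable : CountableFamily M
  M-countable = enumerable⇒countable emℓ (subsetoid (≐-setoid U ℓ) (members M))
    (λ n → -, lift (proj₁ enum n , ≐-refl))
    (λ (S , lift (t , set≐S)) → let n , eq = proj₂ enum t in
      n , subst (λ s → set s ≐ S) (sym eq) set≐S)

  spine : ℕ → (ℕ → Tree) → Tree
  spine zero    s = leaf 0
  spine (suc n) s = node (s 0) (spine n (s ∘ suc))

  env-spine : ∀ n s {i} → i < n → env (spine n s) i ≡ val (s i)
  env-spine (suc n) s {zero}  _         = refl
  env-spine (suc n) s {suc i} (s≤s i<n) = env-spine n (s ∘ suc) i<n

  module _ {g : ℕ → U} {G : ℕ → Pred U ℓ}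
           (g∈N : ∀ i → g i ∈ N) (G∈M : ∀ i → G i ∈ members M) (φ : Formula) where

    private
      n : ℕ
      n = support φ

      s t : Tree
      -- Each membership proof contains a term for its value; the first `n` of these terms become
      -- the arguments of the Skolem function.
      s = spine n (λ i → proj₁ (g∈N i))
      t = spine n (λ i → proj₁ (lower (G∈M i)))

      gₛ : ℕ → U
      gₛ i = proj₁ (proj₁ (env s i))

      Gₜ : ℕ → Pred U ℓ
      Gₜ i = proj₁ (proj₂ (env t i))

      gₛ≈g : Agree _≡_ n gₛ g
      gₛ≈g i i<n = trans (cong (proj₁ ∘ proj₁) (env-spine n _ i<n)) (proj₂ (g∈N i))

      Gₜ≈G : Agree _≐_ n Gₜ G
      Gₜ≈G i i<n = subst (λ v → proj₁ (proj₂ v) ≐ G i)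
        (sym (env-spine n _ i<n)) (proj₂ (lower (G∈M i)))

      g≈gₛ : Agree _≡_ n g gₛ
      g≈gₛ i i<n = sym (gₛ≈g i i<n)

      G≈Gₜ : Agree _≐_ n G Gₜ
      G≈Gₜ i i<n = ≐-sym (Gₜ≈G i i<n)

    -- The Tarski-Vaught condition: pass to `gₛ` and `Gₜ`, which finite trees describe, take the
    -- Skolem witness there, and carry truth back to `g` and `G`.
    witness₁ : ∀ x → 𝔐 , g , G ⊨ ∃₁ x φ →
               ∃[ d ] d ∈ N × (𝔐 , g [ x ← d ] , G ⊨ φ)
    witness₁ x h =
        proj₁ (proj₁ (skolem (∃₁ x φ) gₛ Gₜ))
      , ( node ⌜ ∃₁ x φ ⌝ (node s t)
        , cong (λ χ → proj₁ (proj₁ (skolem χ gₛ Gₜ))) ⌞⌜ ∃₁ x φ ⌝⌟ )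
      , coincidence 𝔐 φ (agree-update _≡_ x refl gₛ≈g) Gₜ≈G
          (ε-spec em (elem 0) (λ d → 𝔐 , gₛ [ x ← proj₁ d ] , Gₜ ⊨ φ)
            -- Quantifying leaves `support` unchanged, so agreement below `n` also transfers the
            -- quantified formula.
            (let d , d∈D , k = coincidence 𝔐 (∃₁ x φ) g≈gₛ G≈Gₜ h
             in (d , d∈D) , k))

    witness₂ : ∀ X → 𝔐 , g , G ⊨ ∃₂ X φ →
               ∃[ S ] S ∈ members M × (𝔐 , g , G [ X ← S ] ⊨ φ)
    witness₂ X h =
        proj₁ (proj₂ (skolem (∃₂ X φ) gₛ Gₜ))
      , lift ( node ⌜ ∃₂ X φ ⌝ (node s t)
             , Setoid.reflexive (≐-setoid U ℓ)
                 (cong (λ χ → proj₁ (proj₂ (skolem χ gₛ Gₜ))) ⌞⌜ ∃₂ X φ ⌝⌟) )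
      , coincidence 𝔐 φ gₛ≈g (agree-update _≐_ X ≐-refl Gₜ≈G)
          (ε-spec em (subset 0) (λ S → 𝔐 , gₛ , Gₜ [ X ← proj₁ S ] ⊨ φ)
            (let S , S∈E , k = coincidence 𝔐 (∃₂ X φ) g≈gₛ G≈Gₜ h
             in (S , S∈E) , k))

  -- Atoms ignore the domains. Only descending through a quantifier needs more than inclusion: the
  -- witness is first moved into the hull, where the induction hypothesis applies.
  elementary : ∀ ψ g G → (∀ x → g x ∈ N) → (∀ X → G X ∈ members M) →
               (⟨ I , N , M ⟩ , g , G ⊨ ψ) ⇔ (𝔐 , g , G ⊨ ψ)
  elementary (rel r x y) g G g∈N G∈M = mk⇔ (λ h → h) (λ h → h)
  elementary (mem X x)   g G g∈N G∈M = mk⇔ (λ h → h) (λ h → h)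
  elementary (¬′ φ)      g G g∈N G∈M = mk⇔ (_∘ from) (_∘ to)
    where open Equivalence (elementary φ g G g∈N G∈M)
  elementary (φ ∧′ ψ)    g G g∈N G∈M = mk⇔
    (λ (h , k) → L.to h , R.to k) (λ (h , k) → L.from h , R.from k)
    where
    module L = Equivalence (elementary φ g G g∈N G∈M)
    module R = Equivalence (elementary ψ g G g∈N G∈M)
  elementary (∃₁ x φ)    g G g∈N G∈M = mk⇔
    (λ (d , d∈N , h) → d , N⊆D d∈N , Equivalence.to (IH d d∈N) h)
    (λ h → let d , d∈N , k = witness₁ g∈N G∈M φ x h
           in d , d∈N , Equivalence.from (IH d d∈N) k)
    where
    IH : ∀ d → d ∈ N → _
    IH d d∈N = elementary φ (g [ x ← d ]) G (update-∈ N g x g∈N d∈N) G∈M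
  elementary (∃₂ X φ)    g G g∈N G∈M = mk⇔
    (λ (S , S∈M , h) → S , M⊆E S∈M , Equivalence.to (IH S S∈M) h)
    (λ h → let S , S∈M , k = witness₂ g∈N G∈M φ X h
           in S , S∈M , Equivalence.from (IH S S∈M) k)
    where
    IH : ∀ S → S ∈ members M → _
    IH S S∈M = elementary φ g (G [ X ← S ]) g∈N (update-∈ (members M) G X G∈M S∈M)

mainTheorem4 : {ℓ : Level} → ExcludedMiddle (lsuc ℓ) →
    (U : Set ℓ) → U →
    (I : Interpretation U) (D : Pred U ℓ) (E : Family U) →
    (D₀ : Pred U ℓ) (E₀ : Family U) →
    D₀ ⊆ D → members E₀ ⊆ members E →
    CountableSubset D₀ → CountableFamily E₀ →
    Satisfiable D₀ → Satisfiable (members E₀) →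
    ∃[ N ] ∃[ M ]
    CountableSubset N × CountableFamily M ×
    D₀ ⊆ N × N ⊆ D ×
    members E₀ ⊆ members M × members M ⊆ members E ×
    ⟨ I , N , M ⟩ ⊆ᴱ ⟨ I , D , E ⟩
mainTheorem4 {ℓ} em U _ I D E D₀ E₀ D₀⊆D E₀⊆E D₀-countable E₀-countable d₀ S₀
  with elem , elem-surj ← countable⇒enumerable (setoid U) D₀ D₀-countable d₀
  with subset , subset-surj ← countable⇒enumerable (≐-setoid U ℓ) (members E₀) E₀-countable S₀
  = N , M , N-countable , M-countable
  -- The constants enumerate `D₀` and `E₀`, so leaves alone already cover both.
  , (λ d∈D₀ → let n , eq = elem-surj (-, d∈D₀) in leaf n , eq) , N⊆D
  , (λ S∈E₀ → let n , eq = subset-surj (-, S∈E₀) in lift (leaf n , eq)) , M⊆E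
  , N⊆D , M⊆E , elementary
  where
  open Hull em I D E
    (λ n → -, D₀⊆D (proj₂ (elem n))) (λ n → -, E₀⊆E (proj₂ (subset n)))
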